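{- Let $8\le m\le n$ and let $c$ be an exact $(m+n+1)$-coloring of $[m]\times[n]$. Then $[m]\times[n]$ contains a rainbow solution to $x_1+x_2=x_3$.
   Context: $[m]\times[n]=\{(i,j)\in\mathbb{Z}^2:1\le i\le m,1\le j\le n\}$ with componentwise addition. An $r$-coloring is a map $c:[m]\times[n]\to\{1,\dots,r\}$, exact if surjective. A rainbow solution to $x_1+x_2=x_3$ is a triple $\alpha,\beta,\gamma\in[m]\times[n]$ with $\alpha+\beta=\gamma$ whose colors are pairwise distinct. -}

module Defs where

open import Data.Nat using (ℕ; _+_; _≤_)
open import Data.Fin using (Fin)
open import Data.Product using (Σ; _×_; _,_; proj₁; proj₂; ∃)
open import Relation.Binary.PropositionalEquality using (_≡_; _≢_)

InGrid : ℕ → ℕ → ℕ × ℕ → Set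
InGrid m n (i , j) = (1 ≤ i × i ≤ m) × (1 ≤ j × j ≤ n)

Grid : ℕ → ℕ → Set
Grid m n = Σ (ℕ × ℕ) (InGrid m n)

pt : ∀ {m n} → Grid m n → ℕ × ℕ
pt = proj₁

_⊕_ : ℕ × ℕ → ℕ × ℕ → ℕ × ℕ
(a , b) ⊕ (c , d) = (a + c , b + d)

Coloring : ℕ → ℕ → ℕ → Set
Coloring m n r = Grid m n → Fin r

Exact : ∀ {m n r} → Coloring m n r → Set
Exact {m} {n} {r} c = (k : Fin r) → ∃ λ (p : Grid m n) → c p ≡ k

RainbowSolution : ∀ {m n r} → Coloring m n r → Set
RainbowSolution {m} {n} c =
  Σ (Grid m n) λ α → Σ (Grid m n) λ β → Σ (Grid m n) λ γ →
    (pt α ⊕ pt β ≡ pt γ) × (c α ≢ c β) × (c α ≢ c γ) × (c β ≢ c γ)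

-- Write D_k for the diagonal j − i = k and suppose there is no rainbow solution.  Two
-- points of D_k differ by a point of D_0, so D_k shows at most one color foreign to D_0.
-- Revealing the diagonals in the order of |k|, call D_k good if it shows a color not seen
-- before, at a point P_k = (i_k , i_k + k).  If D_0 has σ colors and b of the diagonals
-- with k ≠ 0 are not good, then m + n + 1 ≤ σ + (m + n − 2 − b), that is b + 3 ≤ σ.  First
-- occurrences of colors on D_0 at least double, so if t is the first position with a
-- color other than that of (1,1) and u the first position of the last color, then
-- 2 (b + 1) t ≤ u ≤ m.
--
-- For k < l < 2k the difference P_k − P_l lies on a diagonal that was revealed earlier,
-- so it cannot be a grid point; thus i_k ≤ i_l + (l − k).  If i_k = i_{k+1} + 1 > t
-- for some k > 1, then subtracting (t,t) from P_k and (t−1,t−1) from P_{k+1} gives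
-- c(t−1,t) = c(t,t) and c(t,t−1) = c(t−1,t−1); the transposed event gives c(t,t−1) = c(t,t),
-- so one of the two does not occur, say the first.  Then the i_k decrease only across bad
-- diagonals, hence i_κ is at most t plus twice the number of bad D_k with k > κ.
-- Choose κ ≥ b + 2 with D_κ, D_{−κ} and D_{−2κ} good.  If P_κ < (u,u), then (u,u) − P_κ has
-- the color of (u,u), which forces P_{−κ} > P_κ, impossible since D_{−2κ} is good.
-- So u ≤ i_κ + κ, which leaves only b = 0 and t = 2, and then P_2 + P_{−2} ≤ (8,8)
-- is a rainbow sum.
module Submission where

open import Defs
open import Data.Nat using (ℕ; _+_; _≤_)
open import Data.Nat using (zero; suc; pred; _*_; _^_; _∸_; _⊓_; _<_; z≤n; s≤s)
open import Data.Nat.Properties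
open import Data.Nat.Tactic.RingSolver using (solve)
open import Data.Empty using (⊥; ⊥-elim)
open import Data.Fin using (Fin)
import Data.Fin.Properties as Fin
open import Data.List using (List; []; _∷_; length; lookup)
open import Data.List.Membership.Propositional using (_∈_; _∉_)
open import Data.List.Relation.Unary.Any using (here; there; index)
open import Data.List.Relation.Unary.Any.Properties using (lookup-index)
open import Data.Product using (∃; _×_; _,_; proj₁; proj₂)
open import Data.Sum using (_⊎_; inj₁; inj₂; [_,_])
open import Function using (flip; _∘_)
open import Relation.Binary.Definitions using (DecidableEquality; tri<; tri≈; tri>)
open import Relation.Binary.PropositionalEquality
  using (_≡_; _≢_; refl; sym; trans; cong; cong₂; subst)
open import Relation.Nullary using (Dec; yes; no; ¬_)
open import Relation.Nullary.Decidable using (_×-dec_; ¬?)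

-- A linear inequality follows from a sum A ≤ B of hypotheses once the semiring
-- identity a + B + s ≡ b + A is checked; s is the slack.
linear : ∀ {a b A B} s → A ≤ B → a + B + s ≡ b + A → a ≤ b
linear {a} {b} {A} {B} s A≤B eq = +-cancelʳ-≤ B a b
  (≤-trans (m≤m+n (a + B) s) (≤-trans (≤-reflexive eq) (+-monoʳ-≤ b A≤B)))

excess : ∀ {a b} → a < b → ∃ λ o → b ≡ a + suc o
excess {a} {b} a<b with o , eq ← m≤n⇒∃[o]m+o≡n a<b = o , sym (trans (+-suc a o) eq)

total : (ℕ → ℕ) → ℕ → ℕ → ℕ
total f a zero = 0
total f a (suc l) = f a + total f (suc a) l

-- Rainbow-free colorings and the diagonals of the grid.

module _ {A : Set} where

  -- The coordinates of the sum are variables tied by equations, so that each use may write the sum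
  -- in its own form and leave the equations to the ring solver.
  RainbowFree : ℕ → ℕ → (ℕ → ℕ → A) → Set
  RainbowFree m n C = ∀ {a b a′ b′ e f} → 1 ≤ a → 1 ≤ b → 1 ≤ a′ → 1 ≤ b′ →
    a + a′ ≡ e → b + b′ ≡ f → e ≤ m → f ≤ n →
    C a b ≡ C a′ b′ ⊎ C a b ≡ C e f ⊎ C a′ b′ ≡ C e f

  -- The color p does not occur on the diagonals y − x = j with |j| < k.
  Fresh : ℕ → ℕ → (ℕ → ℕ → A) → ℕ → A → Set
  Fresh m n C k p = ∀ {x y} → 1 ≤ x → x ≤ m → 1 ≤ y → y ≤ n →
    x < k + y → y < k + x → C x y ≢ p

  -- The point (i , k + i) of the k-th diagonal above the main one.  Diagonals below
  -- it are handled by transposing, i.e. through Good n m (flip C).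
  record Good (m n : ℕ) (C : ℕ → ℕ → A) (k i : ℕ) : Set where
    constructor good
    field
      positive : 1 ≤ i
      row      : i ≤ m
      column   : k + i ≤ n
      fresh    : Fresh m n C k (C i (k + i))

  flip-rainbowFree : ∀ {m n C} → RainbowFree m n C → RainbowFree n m (flip C)
  flip-rainbowFree rf a b a′ b′ p q e f = rf b a b′ a′ q p f e

  module Diagonals {m n : ℕ} {C : ℕ → ℕ → A} (rf : RainbowFree m n C) where

    -- Two points of D_k differ by some (z,z), which completes them to a solution; the color of P_k
    -- is absent from D_0, so only these alternatives remain. The relation between x, z and i is
    -- kept for `beyondFirstOccurrence`.
    colorsOnDiagonal : ∀ {k i x} → 1 ≤ k → Good m n C k i →
      1 ≤ x → x ≤ m → k + x ≤ n →
      C x (k + x) ≡ C i (k + i) ⊎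
      ∃ λ z → 1 ≤ z × z ≤ m × z ≤ n × C x (k + x) ≡ C z z × (x + z ≡ i ⊎ i + z ≡ x)
    colorsOnDiagonal {k} {i} {x} 1≤k (good 1≤i i≤m ki≤n fr) 1≤x x≤m kx≤n with <-cmp x i
    ... | tri≈ _ refl _ = inj₁ refl
    ... | tri< x<i _ _ with z , refl ← excess x<i
        with rf {x} {k + x} {suc z} {suc z} 1≤x (≤-trans 1≤x (m≤n+m x k)) (s≤s z≤n) (s≤s z≤n)
                refl (+-assoc k x (suc z)) i≤m ki≤n
    ... | inj₁ e = inj₂ (suc z , s≤s z≤n , m+n≤o⇒n≤o x i≤m ,
                     m+n≤o⇒n≤o (k + x) (subst (_≤ n) (sym (+-assoc k x (suc z))) ki≤n) , e , inj₁ refl)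
    ... | inj₂ (inj₁ e) = inj₁ e
    ... | inj₂ (inj₂ e) = ⊥-elim (fr (s≤s z≤n) (m+n≤o⇒n≤o x i≤m) (s≤s z≤n)
            (m+n≤o⇒n≤o (k + x) (subst (_≤ n) (sym (+-assoc k x (suc z))) ki≤n))
            (+-monoˡ-≤ (suc z) 1≤k) (+-monoˡ-≤ (suc z) 1≤k) e)
    colorsOnDiagonal {k} {i} {x} 1≤k (good 1≤i i≤m ki≤n fr) 1≤x x≤m kx≤n | tri> _ _ i<x
        with z , refl ← excess i<x
        with rf {i} {k + i} {suc z} {suc z} 1≤i (≤-trans 1≤i (m≤n+m i k)) (s≤s z≤n) (s≤s z≤n)
                refl (+-assoc k i (suc z)) x≤m kx≤n
    ... | inj₁ e = ⊥-elim (fr (s≤s z≤n) (m+n≤o⇒n≤o i x≤m) (s≤s z≤n)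
            (m+n≤o⇒n≤o (k + i) (subst (_≤ n) (sym (+-assoc k i (suc z))) kx≤n))
            (+-monoˡ-≤ (suc z) 1≤k) (+-monoˡ-≤ (suc z) 1≤k) (sym e))
    ... | inj₂ (inj₁ e) = inj₁ (sym e)
    ... | inj₂ (inj₂ e) = inj₂ (suc z , s≤s z≤n , m+n≤o⇒n≤o i x≤m ,
                     m+n≤o⇒n≤o (k + i) (subst (_≤ n) (sym (+-assoc k i (suc z))) kx≤n) , sym e , inj₂ refl)

    freshDiagonal : ∀ {k i z} → 1 ≤ k → Good m n C k i → 1 ≤ z → z ≤ m → z ≤ n →
      C z z ≢ C i (k + i)
    freshDiagonal 1≤k g 1≤z zm zn = Good.fresh g 1≤z zm 1≤z zn z<k+z z<k+z
      where z<k+z = +-monoˡ-≤ _ 1≤k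

    distinctDiagonals : ∀ {k l i j} → k < l → Good m n C k i → Good m n C l j →
      C i (k + i) ≢ C j (l + j)
    distinctDiagonals {k} {l} {i} k<l (good 1≤i i≤m ki≤n _) (good _ _ _ fr) =
      fr 1≤i i≤m (≤-trans 1≤i (m≤n+m i k)) ki≤n
         (linear (k + k) k<l (solve (i ∷ k ∷ l ∷ [])))
         (+-monoˡ-≤ i k<l)

    rowsNotSteep : ∀ {k i j} g → suc g < k → Good m n C k i → Good m n C (suc g + k) j →
      i ≤ j + suc g
    rowsNotSteep {k} {i} {j} g g<k Gi@(good 1≤i i≤m ki≤n fri) Gj@(good 1≤j j≤m lj≤n frj)
        with <-cmp i (j + suc g)
    ... | tri< lt _ _ = <⇒≤ lt
    ... | tri≈ _ e _ = ≤-reflexive e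
    ... | tri> _ _ gt with excess gt
    ...   | y , refl = ⊥-elim impossible
      where
      1≤k : 1 ≤ k
      1≤k = ≤-trans (s≤s z≤n) g<k
      dx≤m : suc g + suc y ≤ m
      dx≤m = linear j i≤m (solve (j ∷ g ∷ y ∷ m ∷ []))
      dy≤n : suc y ≤ n
      dy≤n = linear (k + j + suc g) ki≤n (solve (j ∷ g ∷ y ∷ k ∷ n ∷ []))
      impossible : ⊥
      impossible
        with rf {j} {suc g + k + j} {suc g + suc y} {suc y}
                {j + suc g + suc y} {k + (j + suc g + suc y)} 1≤j (s≤s z≤n) (s≤s z≤n) (s≤s z≤n)
                (sym (+-assoc j (suc g) (suc y))) (solve (j ∷ g ∷ k ∷ y ∷ [])) i≤m ki≤n
      ... | inj₁ e = frj (s≤s z≤n) dx≤m (s≤s z≤n) dy≤n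
              (linear 0 1≤k (solve (g ∷ k ∷ y ∷ [])))
              (linear (g + g + k + 1) (≤-refl {0}) (solve (g ∷ k ∷ y ∷ []))) (sym e)
      ... | inj₂ (inj₁ e) = distinctDiagonals (s≤s (m≤n+m k g)) Gi Gj (sym e)
      ... | inj₂ (inj₂ e) = fri (s≤s z≤n) dx≤m (s≤s z≤n) dy≤n
              (linear 0 g<k (solve (g ∷ k ∷ y ∷ [])))
              (linear (g + k) (≤-refl {1}) (solve (g ∷ k ∷ y ∷ []))) e

    -- The argument is the t - 1 of the header. Each equality is combined with the other one of the
    -- transposed coloring in `noFrame`.
    Descends : ℕ → Set
    Descends t = C t (suc t) ≡ C (suc t) (suc t) × C (suc t) t ≡ C t t

    descent : ∀ {k j t} → 1 < k → 1 ≤ t → t < j →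
      Good m n C k (suc j) → Good m n C (suc k) j → Descends t
    descent {k} {j} {t} 1<k 1≤t t<j Gi@(good _ i≤m ki≤n fri) Gj@(good _ j≤m lj≤n frj)
        with excess t<j
    ... | o , refl = left , right
      where
      1≤k : 1 ≤ k
      1≤k = <⇒≤ 1<k
      o≤m : suc o ≤ m
      o≤m = m+n≤o⇒n≤o t j≤m
      ko≤n : k + suc o ≤ n
      ko≤n = linear (suc t) ki≤n (solve (k ∷ o ∷ t ∷ n ∷ []))
      lo≤n : suc k + suc o ≤ n
      lo≤n = linear t lj≤n (solve (k ∷ o ∷ t ∷ n ∷ []))
      t<m : suc t ≤ m
      t<m = linear (suc o) i≤m (solve (o ∷ t ∷ m ∷ []))
      t<n : suc t ≤ n
      t<n = linear (k + suc o) ki≤n (solve (k ∷ o ∷ t ∷ n ∷ []))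
      1≤ko : 1 ≤ k + suc o
      1≤ko = ≤-trans 1≤k (m≤m+n k (suc o))
      left : C t (suc t) ≡ C (suc t) (suc t)
      left with rf {suc o} {k + suc o} {t} {suc t} {t + suc o} {suc k + (t + suc o)}
                   (s≤s z≤n) 1≤ko 1≤t (s≤s z≤n)
                   (+-comm (suc o) t) (solve (k ∷ o ∷ t ∷ [])) j≤m lj≤n
      ... | inj₂ (inj₁ e) = ⊥-elim (frj (s≤s z≤n) o≤m 1≤ko ko≤n
              (linear (k + k) (≤-refl {1}) (solve (k ∷ o ∷ []))) ≤-refl e)
      ... | inj₂ (inj₂ e) = ⊥-elim (frj 1≤t (<⇒≤ t<m) (s≤s z≤n) t<n
              (linear (suc k) (≤-refl {0}) (solve (k ∷ t ∷ [])))
              (linear 0 1≤k (solve (k ∷ t ∷ []))) e)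
      ... | inj₁ e
          with rf {suc o} {k + suc o} {suc t} {suc t} {suc (t + suc o)} {k + suc (t + suc o)}
                   (s≤s z≤n) 1≤ko (s≤s z≤n) (s≤s z≤n)
                   (solve (o ∷ t ∷ [])) (solve (k ∷ o ∷ t ∷ [])) i≤m ki≤n
      ...   | inj₁ e′ = trans (sym e) e′
      ...   | inj₂ (inj₁ e′) = ⊥-elim (fri 1≤t (<⇒≤ t<m) (s≤s z≤n) t<n
              (linear k (≤-refl {1}) (solve (k ∷ t ∷ [])))
              (linear 0 1<k (solve (k ∷ t ∷ []))) (trans (sym e) e′))
      ...   | inj₂ (inj₂ e′) = ⊥-elim (freshDiagonal 1≤k Gi (s≤s z≤n) t<m t<n e′)
      right : C (suc t) t ≡ C t t
      right with rf {suc o} {suc k + suc o} {suc t} {t} {suc (t + suc o)} {k + suc (t + suc o)}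
                   (s≤s z≤n) (s≤s z≤n) (s≤s z≤n) 1≤t
                   (solve (o ∷ t ∷ [])) (solve (k ∷ o ∷ t ∷ [])) i≤m ki≤n
               | rf {suc o} {suc k + suc o} {t} {t} {t + suc o} {suc k + (t + suc o)}
                   (s≤s z≤n) (s≤s z≤n) 1≤t 1≤t
                   (+-comm (suc o) t) (solve (k ∷ o ∷ t ∷ [])) j≤m lj≤n
      ... | inj₂ (inj₂ e) | _ = ⊥-elim (fri (s≤s z≤n) t<m 1≤t (<⇒≤ t<n)
              (linear 0 1<k (solve (k ∷ t ∷ [])))
              (linear k (≤-refl {1}) (solve (k ∷ t ∷ []))) e)
      ... | _ | inj₂ (inj₂ e′) = ⊥-elim (freshDiagonal (s≤s z≤n) Gj 1≤t (<⇒≤ t<m) (<⇒≤ t<n) e′)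
      ... | inj₁ e | inj₁ e′ = trans (sym e) e′
      ... | inj₁ e | inj₂ (inj₁ e′) = ⊥-elim (frj (s≤s z≤n) t<m 1≤t (<⇒≤ t<n)
              (linear 0 1≤k (solve (k ∷ t ∷ [])))
              (linear (1 + k) (≤-refl {1}) (solve (k ∷ t ∷ []))) (trans (sym e) e′))
      ... | inj₂ (inj₁ e) | inj₁ e′ =
              ⊥-elim (freshDiagonal 1≤k Gi 1≤t (<⇒≤ t<m) (<⇒≤ t<n) (trans (sym e′) e))
      ... | inj₂ (inj₁ e) | inj₂ (inj₁ e′) =
              ⊥-elim (distinctDiagonals ≤-refl Gi Gj (trans (sym e) e′))

    -- Across g ≥ 1 bad diagonals the row drops by at most g + 1 ≤ 2 g, which the term 2 (g + T)
    -- pays for. For g = 0 a drop is by exactly one, and from beyond row s + 1 it is a `descent`.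
    descentOrRow : ∀ {k i r s T} g → 1 < k → 1 ≤ s → Good m n C k i → Good m n C (suc g + k) r →
      i ≤ r + suc g → r ≤ suc s + 2 * T → Descends s ⊎ i ≤ suc s + 2 * (g + T)
    descentOrRow {k} {i} {r} {s} {T} (suc g) _ _ _ _ steep h =
      inj₂ (linear g (+-mono-≤ h steep) (solve (g ∷ i ∷ r ∷ s ∷ T ∷ [])))
    descentOrRow {k} {i} {r} {s} {T} zero 1<k 1≤s Gi Gr steep h with <-cmp i (suc r) | ≤-<-connex i (suc s)
    ... | _ | inj₁ i≤s = inj₂ (≤-trans i≤s (m≤m+n (suc s) _))
    ... | tri< i≤r _ _ | _ = inj₂ (≤-trans (≤-pred i≤r) h)
    ... | tri> _ _ gt | _ = ⊥-elim (<⇒≱ gt (≤-trans steep (≤-reflexive (+-comm r 1))))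
    ... | tri≈ _ e _ | inj₂ s<i =
      inj₁ (descent 1<k 1≤s (≤-pred (subst (suc s <_) e s<i)) (subst (Good m n C k) e Gi) Gr)

    -- The diagonals strictly between k and l are bad, and g is their number.
    descentOrFew : (bad row : ℕ → ℕ) →
      (∀ {k} → 1 ≤ k → k < n → bad k ≡ 0 → Good m n C k (row k)) →
      ∀ {s b} → 1 ≤ s → ∀ f {k i l} g → l ≡ suc g + k → l + f ≡ n → suc b < k →
      g + total bad l f ≤ b → Good m n C k i →
      Descends s ⊎ i ≤ suc s + 2 * (g + total bad l f)
    -- Here l = n, so the column bound of P_k alone gives i ≤ g + 1.
    descentOrFew bad row isGood {s} {b} 1≤s zero {k} {i} g refl l+f b<k g≤b Gi =
      inj₂ (linear (s + g) (≤-trans (Good.column Gi) (≤-reflexive (sym l+f))) (solve (i ∷ k ∷ g ∷ s ∷ [])))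
    descentOrFew bad row isGood {s} {b} 1≤s (suc f) {k} {i} {l} g refl l+f b<k g≤b Gi with bad l in bl
    ... | suc c with descentOrFew bad row isGood {s} {b} 1≤s f {k} {i} (suc g) refl
                       (trans (sym (+-suc l f)) l+f) b<k (fewer (total bad (suc l) f) g≤b) Gi
      where
      fewer : ∀ T → g + (suc c + T) ≤ b → suc g + T ≤ b
      fewer T h = linear c h (solve (g ∷ c ∷ b ∷ T ∷ []))
    ...   | inj₁ v = inj₁ v
    ...   | inj₂ h = inj₂ (more (total bad (suc l) f) h)
      where
      more : ∀ T → i ≤ suc s + 2 * (suc g + T) → i ≤ suc s + 2 * (g + (suc c + T))
      more T h = linear (c + c) h (solve (g ∷ c ∷ i ∷ s ∷ T ∷ []))
    descentOrFew bad row isGood {s} {b} 1≤s (suc f) {k} {i} {l} g refl l+f b<k g≤b Gi | zero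
      with isGood {l} (s≤s z≤n) l<n bl
      where
      l<n : suc l ≤ n
      l<n = ≤-trans (m≤m+n (suc l) f) (≤-reflexive (trans (sym (+-suc l f)) l+f))
    ... | Gl with descentOrFew bad row isGood {s} {b} 1≤s f {l} {row l} {suc l} 0 refl
                       (trans (sym (+-suc l f)) l+f) (≤-trans b<k (m≤n+m k (suc g)))
                       (m+n≤o⇒n≤o g g≤b) Gl
                | rowsNotSteep g (≤-trans (s≤s (s≤s (m+n≤o⇒m≤o g g≤b))) b<k) Gi Gl
    ...   | inj₁ v | _ = inj₁ v
    ...   | inj₂ h | steep =
            descentOrRow g (≤-trans (s≤s (s≤s z≤n)) b<k) 1≤s Gi Gl steep h

  module Opposite {m n : ℕ} {C : ℕ → ℕ → A} (rf : RainbowFree m n C)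
      {k i j : ℕ} (1≤k : 1 ≤ k)
      (Gi : Good m n C k i) (Gj : Good n m (flip C) k j)
      (apart : C i (k + i) ≢ C (k + j) j) where

    open Good Gi
    open Good Gj using () renaming (positive to positive′; row to row′; column to column′)
    open Diagonals rf
    private module Flip = Diagonals (flip-rainbowFree rf)

    sumOutside : k + i + j ≤ m → k + i + j ≤ n → ⊥
    sumOutside sm sn
        with rf {i} {k + i} {k + j} {j} {k + i + j} {k + i + j} positive (≤-trans 1≤k (m≤m+n k i))
                (≤-trans 1≤k (m≤m+n k j)) positive′ (solve (i ∷ j ∷ k ∷ [])) refl sm sn
    ... | inj₁ e = apart e
    ... | inj₂ (inj₁ e) = freshDiagonal 1≤k Gi (≤-trans positive′ (m≤n+m j (k + i))) sm sn (sym e)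
    ... | inj₂ (inj₂ e) = Flip.freshDiagonal 1≤k Gj (≤-trans positive′ (m≤n+m j (k + i))) sn sm (sym e)

    notAbove : (k + k < m → ∃ (Good n m (flip C) (k + k))) → j ≤ k + i
    notAbove G₂ with <-cmp j (k + i)
    ... | tri< lt _ _ = <⇒≤ lt
    ... | tri≈ _ e _ = ≤-reflexive e
    ... | tri> _ _ gt with excess gt
    ...   | y , refl = ⊥-elim impossible
      where
      x≤m : k + k + suc y ≤ m
      x≤m = linear i column′ (solve (i ∷ k ∷ y ∷ m ∷ []))
      y≤n : suc y ≤ n
      y≤n = m+n≤o⇒n≤o (k + i) row′
      1≤2k : 1 ≤ k + k
      1≤2k = ≤-trans 1≤k (m≤m+n k k)
      k<2k : k < k + k
      k<2k = +-monoˡ-≤ k 1≤k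
      G = G₂ (linear y x≤m (solve (k ∷ y ∷ m ∷ [])))
      1≤x : 1 ≤ k + k + suc y
      1≤x = ≤-trans 1≤2k (m≤m+n (k + k) (suc y))
      upper : C (k + k + suc y) (suc y) ≢ C i (k + i)
      upper e with Flip.colorsOnDiagonal {k + k} {_} {suc y} 1≤2k (proj₂ G) (s≤s z≤n) y≤n x≤m
      ... | inj₁ e′ = Good.fresh (proj₂ G) (≤-trans 1≤k (m≤m+n k i)) column positive row
              (+-monoˡ-≤ i k<2k) (linear (k + k) 1≤k (solve (i ∷ k ∷ []))) (trans (sym e) e′)
      ... | inj₂ (z , 1≤z , zn , zm , e′ , _) = freshDiagonal 1≤k Gi 1≤z zm zn (trans (sym e′) e)
      lower : C (k + k + suc y) (suc y) ≢ C (k + (k + i + suc y)) (k + i + suc y)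
      lower e with Flip.colorsOnDiagonal {k + k} {_} {suc y} 1≤2k (proj₂ G) (s≤s z≤n) y≤n x≤m
      ... | inj₁ e′ = Flip.distinctDiagonals k<2k Gj (proj₂ G) (trans (sym e) e′)
      ... | inj₂ (z , 1≤z , zn , zm , e′ , _) = Flip.freshDiagonal 1≤k Gj 1≤z zn zm (trans (sym e′) e)
      impossible : ⊥
      impossible with rf {i} {k + i} {k + k + suc y} {suc y} {k + (k + i + suc y)} {k + i + suc y}
                positive (≤-trans 1≤k (m≤m+n k i)) 1≤x (s≤s z≤n)
                (solve (i ∷ k ∷ y ∷ [])) refl column′ row′
      ... | inj₁ e = upper (sym e)
      ... | inj₂ (inj₁ e) = apart e
      ... | inj₂ (inj₂ e) = lower e

    beyondFirstOccurrence : (k + k < m → ∃ (Good n m (flip C) (k + k))) →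
      ∀ {u} → u ≤ m → u ≤ n → (∀ {z} → 1 ≤ z → z < u → C z z ≢ C u u) → u ≤ k + i
    beyondFirstOccurrence G₂ {u} um un first with <-cmp u (k + i)
    ... | tri< lt _ _ = <⇒≤ lt
    ... | tri≈ _ e _ = ≤-reflexive e
    ... | tri> _ _ gt with excess gt
    ...   | y , refl = ⊥-elim impossible
      where
      x≤m : k + suc y ≤ m
      x≤m = linear i um (solve (i ∷ k ∷ y ∷ m ∷ []))
      y≤n : suc y ≤ n
      y≤n = m+n≤o⇒n≤o (k + i) un
      1≤u : 1 ≤ k + i + suc y
      1≤u = ≤-trans (s≤s z≤n) (m≤n+m (suc y) (k + i))
      impossible : ⊥
      impossible
        with rf {i} {k + i} {k + suc y} {suc y} {k + i + suc y} {k + i + suc y}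
                positive (≤-trans 1≤k (m≤m+n k i)) (≤-trans 1≤k (m≤m+n k (suc y))) (s≤s z≤n)
                (solve (i ∷ k ∷ y ∷ [])) refl um un
           | Flip.colorsOnDiagonal {k} {j} {suc y} 1≤k Gj (s≤s z≤n) y≤n x≤m
      ... | inj₂ (inj₁ e) | _ = freshDiagonal 1≤k Gi 1≤u um un (sym e)
      ... | inj₁ e | inj₁ e′ = apart (trans e e′)
      ... | inj₁ e | inj₂ (z , 1≤z , zn , zm , e′ , _) = freshDiagonal 1≤k Gi 1≤z zm zn (sym (trans e e′))
      ... | inj₂ (inj₂ e) | inj₁ e′ = Flip.freshDiagonal 1≤k Gj 1≤u un um (trans (sym e) e′)
      ... | inj₂ (inj₂ e) | inj₂ (z , 1≤z , zn , zm , e′ , inj₂ q) =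
              first 1≤z (linear (k + i) (+-mono-≤ (≤-reflexive q) positive′) (solve (i ∷ j ∷ k ∷ y ∷ z ∷ [])))
                    (trans (sym e′) e)
      ... | inj₂ (inj₂ e) | inj₂ (z , 1≤z , zn , zm , e′ , inj₁ q) =
              first 1≤z (linear (suc (y + y)) (+-mono-≤ (≤-reflexive q) (notAbove G₂)) (solve (i ∷ j ∷ k ∷ y ∷ z ∷ [])))
                    (trans (sym e′) e)

-- Counting bad diagonals.

total-++ : ∀ f a p q → total f a (p + q) ≡ total f a p + total f (a + p) q
total-++ f a zero q = cong (λ x → total f x q) (sym (+-identityʳ a))
total-++ f a (suc p) q = trans
  (cong (f a +_) (trans (total-++ f (suc a) p q)
                        (cong (λ x → total f (suc a) p + total f x q) (sym (+-suc a p)))))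
  (sym (+-assoc (f a) _ _))

total-suc : ∀ f a r → total f a (suc r) ≡ total f a r + f (a + r)
total-suc f a r = trans (cong (total f a) (+-comm 1 r))
  (trans (total-++ f a r 1) (cong (total f a r +_) (+-identityʳ (f (a + r)))))

double : ℕ → ℕ
double k = k + k

total-double : ∀ f a r → total (f ∘ double) a r ≤ total f (double a) (double r)
total-double f a zero = z≤n
total-double f a (suc r) rewrite +-suc r r | sym (+-suc a a) =
  +-monoʳ-≤ (f (double a)) (≤-trans (total-double f (suc a) r) (m≤n+m _ (f (a + suc a))))

-- The indices a, ..., a + r - 1 stay below 2a, where the doubled indices start, so no index is
-- counted twice.
total-disjoint : ∀ {f S} → (∀ l → total f 0 l ≤ S) → ∀ a r → r ≤ a →
  total f a r + total (f ∘ double) a r ≤ S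
total-disjoint {f} {S} bounded a r r≤a with m≤n⇒∃[o]m+o≡n r≤a
... | o , eq = ≤-trans (+-mono-≤ first (total-double f a r))
                 (≤-trans (≤-reflexive (sym (total-++ f 0 (double a) (double r)))) (bounded (double a + double r)))
  where
  first : total f a r ≤ total f 0 (double a)
  first rewrite total-++ f 0 a a =
    ≤-trans (≤-trans (m≤m+n (total f a r) (total f (a + r) o))
              (≤-reflexive (trans (sym (total-++ f a r o)) (cong (total f a) eq))))
            (m≤n+m (total f a a) (total f 0 a))

module _ {f g : ℕ → ℕ} {F G : ℕ}
  (f≤F : ∀ l → total f 0 l ≤ F) (g≤G : ∀ l → total g 0 l ≤ G) where

  private
    b = F + G
    -- From b + 2 on, every gap g + 1 ≤ b + 1 is smaller than the index, as `rowsNotSteep` asks, and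
    -- `total-disjoint` covers all b + 1 candidates.
    a = suc (suc b)

  -- A bad index excludes at most one of the candidates a + r with r ≤ b, because 2 (a + r)
  -- exceeds all of them.
  goodIndex : ∃ λ r → f (a + r) ≡ 0 × g (a + r) ≡ 0 × g (double (a + r)) ≡ 0 ×
    (∀ l → r + total f (a + r) l ≤ b)
  goodIndex = search (suc b) 0 refl z≤n
    where
    -- Each rejected candidate is charged to a bad diagonal of its own, none of them among the upper
    -- ones still ahead; so r rejections leave at most b - r bad ones there.
    killed : ℕ → ℕ
    killed r = total f a r + (total g a r + total (g ∘ double) a r)

    killed-bound : ∀ r → r ≤ a → ∀ l → killed r + total f (a + r) l ≤ b
    killed-bound r r≤a l = rearrange (total f a r) (total f (a + r) l)
      (≤-trans (m≤n+m _ (total f 0 a)) (≤-trans (≤-reflexive eq) (f≤F (a + (r + l)))))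
      (total-disjoint g≤G a r r≤a)
      where
      eq : total f 0 a + (total f a r + total f (a + r) l) ≡ total f 0 (a + (r + l))
      eq = sym (trans (total-++ f 0 a (r + l)) (cong (total f 0 a +_) (total-++ f a r l)))
      rearrange : ∀ x y {z} → x + y ≤ F → z ≤ G → x + z + y ≤ F + G
      rearrange x y {z} p q = linear 0 (+-mono-≤ p q) (solve (x ∷ y ∷ z ∷ F ∷ G ∷ []))

    killed-suc : ∀ r → r ≤ killed r →
      1 ≤ f (a + r) + (g (a + r) + g (double (a + r))) → suc r ≤ killed (suc r)
    killed-suc r r≤ 1≤ =
      ≤-trans (rearrange (f (a + r)) (g (a + r)) (g (double (a + r)))
                (total f a r) (total g a r) (total (g ∘ double) a r) r≤ 1≤)
        (≤-reflexive (sym (cong₂ _+_ (total-suc f a r)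
          (cong₂ _+_ (total-suc g a r) (total-suc (g ∘ double) a r)))))
      where
      rearrange : ∀ x y z x′ y′ z′ → r ≤ x′ + (y′ + z′) → 1 ≤ x + (y + z) →
        suc r ≤ (x′ + x) + ((y′ + y) + (z′ + z))
      rearrange x y z x′ y′ z′ p q =
        linear 0 (+-mono-≤ p q) (solve (r ∷ x ∷ y ∷ z ∷ x′ ∷ y′ ∷ z′ ∷ []))

    search : ∀ fuel r → r + fuel ≡ suc b → r ≤ killed r →
      ∃ λ r → f (a + r) ≡ 0 × g (a + r) ≡ 0 × g (double (a + r)) ≡ 0 ×
        (∀ l → r + total f (a + r) l ≤ b)
    search zero r eq r≤ = ⊥-elim (1+n≰n (≤-trans (≤-reflexive (trans (sym eq) (+-identityʳ r)))
      (≤-trans (≤-trans r≤ (m≤m+n (killed r) 0))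
               (killed-bound r (≤-trans (≤-reflexive (trans (sym (+-identityʳ r)) eq)) (n≤1+n _)) 0))))
    search (suc fuel) r eq r≤ with f (a + r) in p | g (a + r) in q | g (double (a + r)) in v
    ... | zero | zero | zero = r , p , q , v , λ l →
      ≤-trans (+-monoˡ-≤ (total f (a + r) l) r≤)
        (killed-bound r (≤-trans (m≤m+n r (suc fuel)) (≤-trans (≤-reflexive eq) (n≤1+n _))) l)
    ... | suc x | y | z = search fuel (suc r) (trans (sym (+-suc r fuel)) eq)
      (killed-suc r r≤ (≤-trans (≤-trans (s≤s z≤n) (≤-reflexive (sym p))) (m≤m+n (f (a + r)) _)))
    ... | zero | suc y | z = search fuel (suc r) (trans (sym (+-suc r fuel)) eq)
      (killed-suc r r≤ (≤-trans (≤-trans (≤-trans (s≤s z≤n) (≤-reflexive (sym q))) (m≤m+n (g (a + r)) _))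
                                (m≤n+m _ (f (a + r)))))
    ... | zero | zero | suc z = search fuel (suc r) (trans (sym (+-suc r fuel)) eq)
      (killed-suc r r≤ (≤-trans (≤-trans (≤-trans (s≤s z≤n) (≤-reflexive (sym v))) (m≤n+m _ (g (a + r))))
                                (m≤n+m _ (f (a + r)))))

-- In the notation of the header, t is suc s; the suffixes U and L refer to the
-- diagonals above and below the main one.
record Frame {A : Set} (m n : ℕ) (C : ℕ → ℕ → A) : Set where
  field
    rainbowFree : RainbowFree m n C
    8≤m : 8 ≤ m
    8≤n : 8 ≤ n
    badU badL rowU rowL : ℕ → ℕ
    boundU boundL : ℕ
    totalU : ∀ l → total badU 0 l ≤ boundU
    totalL : ∀ l → total badL 0 l ≤ boundL
    goodU : ∀ {k} → 1 ≤ k → k < n → badU k ≡ 0 → Good m n C k (rowU k)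
    goodL : ∀ {k} → 1 ≤ k → k < m → badL k ≡ 0 → Good n m (flip C) k (rowL k)
    apart : ∀ {k} → 1 ≤ k → k < n → k < m → badU k ≡ 0 → badL k ≡ 0 →
      C (rowU k) (k + rowU k) ≢ C (k + rowL k) (rowL k)
    s u : ℕ
    1≤s : 1 ≤ s
    jump : C s s ≢ C (suc s) (suc s)
    u≤m : u ≤ m
    u≤n : u ≤ n
    firstOccurrence : ∀ {z} → 1 ≤ z → z < u → C z z ≢ C u u
    budget : 2 * suc (boundU + boundL) * suc s ≤ u

-- The contradiction within a frame.

index-below : ∀ {b r u} s → 1 ≤ s → 2 * suc b * suc s ≤ u → r ≤ b → suc (suc b) + r < u
index-below {b} {r} {u} (suc s) _ p q = linear (2 * b + 1 + 2 * suc b * s) (+-mono-≤ p q)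
  (solve (b ∷ r ∷ s ∷ u ∷ []))

-- Here `s` is t - 2. The lower bound on u is 2bs + 4b + 2s + 4, the upper one at most 3b + s + 4.
budget-tight : ∀ {s u} b r T i → 2 * suc b * suc (suc s) ≤ u → r + T ≤ b →
  i ≤ suc (suc s) + 2 * T → u ≤ suc (suc b) + r + i → b + s ≤ 0
budget-tight {s} {u} b r T i p q v w =
  linear (2 * b * s + r) (+-mono-≤ p (+-mono-≤ q (+-mono-≤ q (+-mono-≤ v w))))
    (solve (b ∷ r ∷ T ∷ i ∷ s ∷ u ∷ []))

-- The source of the 8: b = 0 and t = 2 give κ = 2, i ≤ 2 and j ≤ 4.
sum≤8 : ∀ {s} b r T i j → b + s ≤ 0 → r + T ≤ b → i ≤ suc (suc s) + 2 * T →
  j ≤ suc (suc b) + r + i → suc (suc b) + r + i + j ≤ 8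
sum≤8 {s} b r T i j p q v w = linear (2 * r + 4 * s)
  (+-mono-≤ p₆ (+-mono-≤ (*-monoʳ-≤ 4 q) (+-mono-≤ (*-monoʳ-≤ 2 v) w))) identity
  where
  p₆ : 6 * (b + s) ≤ 0
  p₆ = *-monoʳ-≤ 6 p
  identity : suc (suc b) + r + i + j +
      (0 + (4 * b + (2 * (suc (suc s) + 2 * T) + (suc (suc b) + r + i)))) + (2 * r + 4 * s) ≡
    8 + (6 * (b + s) + (4 * (r + T) + (2 * i + j)))
  identity = solve (b ∷ r ∷ T ∷ i ∷ j ∷ s ∷ [])

module _ {A : Set} {m n : ℕ} {C : ℕ → ℕ → A} where

  transpose : Frame m n C → Frame n m (flip C)
  transpose F = record
    { rainbowFree = flip-rainbowFree rainbowFree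
    ; 8≤m = 8≤n ; 8≤n = 8≤m
    ; badU = badL ; badL = badU ; rowU = rowL ; rowL = rowU
    ; boundU = boundL ; boundL = boundU ; totalU = totalL ; totalL = totalU
    ; goodU = goodL ; goodL = goodU
    ; apart = λ 1≤k k<m k<n p q e → apart 1≤k k<n k<m q p (sym e)
    ; s = s ; u = u ; 1≤s = 1≤s ; jump = jump ; u≤m = u≤n ; u≤n = u≤m
    ; firstOccurrence = firstOccurrence
    ; budget = subst (λ b → 2 * suc b * suc s ≤ u) (+-comm boundU boundL) budget
    }
    where open Frame F

  descends : (F : Frame m n C) → Diagonals.Descends (Frame.rainbowFree F) (Frame.s F)
  descends F with goodIndex (Frame.totalU F) (Frame.totalL F)
  ... | r , pU , pL , pL₂ , few = go s refl
    where
    open Frame F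
    open Diagonals rainbowFree
    b = boundU + boundL
    κ = suc (suc b) + r
    κ<u : κ < u
    κ<u = index-below s 1≤s budget (m+n≤o⇒m≤o r (few 0))
    κ<m = ≤-trans κ<u u≤m
    κ<n = ≤-trans κ<u u≤n
    1≤κ : 1 ≤ κ
    1≤κ = s≤s z≤n
    Gκ = goodU 1≤κ κ<n pU
    open Opposite rainbowFree 1≤κ Gκ (goodL 1≤κ κ<m pL) (apart 1≤κ κ<n κ<m pU pL)
    G₂ : κ + κ < m → ∃ (Good n m (flip C) (κ + κ))
    G₂ 2κ<m = _ , goodL (s≤s z≤n) 2κ<m pL₂
    rest = m≤n⇒∃[o]m+o≡n κ<n
    f = proj₁ rest
    T = total badU (suc κ) f
    fewAbove : r + T ≤ b
    fewAbove = subst (λ x → r + (x + T) ≤ b) pU (few (suc f))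
    go : ∀ s′ → s ≡ s′ → Descends s
    go zero refl = ⊥-elim (n≮0 1≤s)
    go (suc s′) refl with descentOrFew badU rowU goodU {s} {b} 1≤s f {κ} {rowU κ} 0 refl (proj₂ rest)
                            (m≤m+n (suc (suc b)) r) (m+n≤o⇒n≤o r fewAbove) Gκ
    ... | inj₁ v = v
    ... | inj₂ h = ⊥-elim (sumOutside (≤-trans small 8≤m) (≤-trans small 8≤n))
      where
      small : κ + rowU κ + rowL κ ≤ 8
      small = sum≤8 {s = s′} b r T (rowU κ) (rowL κ)
        (budget-tight b r T (rowU κ) budget fewAbove h (beyondFirstOccurrence G₂ u≤m u≤n firstOccurrence))
        fewAbove h (notAbove G₂)

-- The frame and its transpose give (s+1, s) the color of (s,s) and that of (s+1,s+1).
noFrame : {A : Set} {m n : ℕ} {C : ℕ → ℕ → A} → Frame m n C → ⊥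
noFrame F = Frame.jump F (trans (sym (proj₂ (descends F))) (proj₁ (descends (transpose F))))

-- Bounds for sums over diagonals and for powers of two.

total-beyond : ∀ {f N} → (∀ k → N ≤ k → f k ≡ 0) → ∀ l a → N ≤ a → total f a l ≡ 0
total-beyond vanish zero a N≤a = refl
total-beyond vanish (suc l) a N≤a =
  cong₂ _+_ (vanish a N≤a) (total-beyond vanish l (suc a) (m≤n⇒m≤1+n N≤a))

total-bounded : ∀ {f N} → (∀ k → N ≤ k → f k ≡ 0) → ∀ l → total f 0 l ≤ total f 0 N
total-bounded {f} {N} vanish l with ≤-total l N
... | inj₁ l≤N with o , refl ← m≤n⇒∃[o]m+o≡n l≤N =
  ≤-trans (m≤m+n (total f 0 l) (total f l o)) (≤-reflexive (sym (total-++ f 0 l o)))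
... | inj₂ N≤l with o , refl ← m≤n⇒∃[o]m+o≡n N≤l =
  ≤-reflexive (trans (total-++ f 0 N o)
    (trans (cong (total f 0 N +_) (total-beyond vanish o N ≤-refl)) (+-identityʳ _)))

-- The k-th diagonal has p ⊓ (q ∸ k) points, so the summand indicates that it is nonempty.
total-nonempty : ∀ p q a l → total (λ k → (p ⊓ (q ∸ k)) ⊓ 1) a l ≤ q ∸ a
total-nonempty p q a zero = z≤n
total-nonempty p q a (suc l) =
  ≤-trans (+-mono-≤ (⊓-monoˡ-≤ 1 (m⊓n≤n p (q ∸ a))) (total-nonempty p q (suc a) l))
    (subst (λ x → ((q ∸ a) ⊓ 1) + x ≤ q ∸ a) (pred[m∸n]≡m∸[1+n] q a) (peel (q ∸ a)))
  where
  peel : ∀ x → x ⊓ 1 + pred x ≤ x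
  peel zero = z≤n
  peel (suc x) = +-monoˡ-≤ x (m⊓n≤n (suc x) 1)

positive-∸ : ∀ {i} k {n} → 1 ≤ i → i ≤ n ∸ k → k + i ≤ n
positive-∸ zero 1≤i i≤ = i≤
positive-∸ (suc k) {zero} 1≤i i≤ = ⊥-elim (n≮0 (≤-trans 1≤i i≤))
positive-∸ (suc k) {suc n} 1≤i i≤ = s≤s (positive-∸ k 1≤i i≤)

2*m≤2^m : ∀ e → 2 * e ≤ 2 ^ e
2*m≤2^m zero = z≤n
2*m≤2^m (suc zero) = ≤-refl
2*m≤2^m (suc (suc e)) = *-monoʳ-≤ 2
  (≤-trans (s≤s (≤-trans (m≤m+n (suc e) 0) (m≤n+m (suc e + 0) e))) (2*m≤2^m (suc e)))

-- Revealing the colors greedily.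

module Greedy {A : Set} (_≟_ : DecidableEquality A) where

  open import Data.List.Membership.DecPropositional _≟_ using (_∈?_)

  Outcome : (ℕ → A) → ℕ → List A → Set
  Outcome f N seen =
    (∃ λ i → 1 ≤ i × i ≤ N × f i ∉ seen) ⊎ (∀ {i} → 1 ≤ i → i ≤ N → f i ∈ seen)

  outcome : ∀ f N seen → Outcome f N seen
  outcome f zero seen = inj₂ λ 1≤i i≤0 → ⊥-elim (n≮0 (≤-trans 1≤i i≤0))
  outcome f (suc N) seen with f (suc N) ∈? seen | outcome f N seen
  ... | no new | _ = inj₁ (suc N , s≤s z≤n , ≤-refl , new)
  ... | yes _ | inj₁ (i , 1≤i , i≤N , new) = inj₁ (i , 1≤i , m≤n⇒m≤1+n i≤N , new)
  ... | yes old | inj₂ all = inj₂ λ {i} 1≤i i≤N → [ (λ i<N → all 1≤i (≤-pred i<N))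
                                                 , (λ { refl → old }) ] (m≤n⇒m<n∨m≡n i≤N)

  module _ {f : ℕ → A} {N : ℕ} {seen : List A} where

    grow : Outcome f N seen → List A
    grow (inj₁ (i , _)) = f i ∷ seen
    grow (inj₂ _) = seen

    -- The minimum keeps an empty diagonal from counting as bad.
    bad : Outcome f N seen → ℕ
    bad (inj₁ _) = 0
    bad (inj₂ _) = N ⊓ 1

    row : Outcome f N seen → ℕ
    row (inj₁ (i , _)) = i
    row (inj₂ _) = 0

    grow-⊇ : ∀ o {p} → p ∈ seen → p ∈ grow o
    grow-⊇ (inj₁ _) = there
    grow-⊇ (inj₂ _) p∈ = p∈

    bad≤ : ∀ o → bad o ≤ N ⊓ 1
    bad≤ (inj₁ _) = z≤n
    bad≤ (inj₂ _) = ≤-refl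

    length-grow : ∀ o → length (grow o) + bad o ≤ length seen + N ⊓ 1
    length-grow (inj₁ (i , 1≤i , i≤N , _)) = ≤-reflexive (trans (+-identityʳ _)
      (trans (+-comm 1 (length seen)) (cong (length seen +_) (sym (m≥n⇒m⊓n≡n (≤-trans 1≤i i≤N))))))
    length-grow (inj₂ _) = ≤-refl

    found : ∀ o → 1 ≤ N → bad o ≡ 0 →
      1 ≤ row o × row o ≤ N × f (row o) ∉ seen × f (row o) ∈ grow o
    found (inj₁ (i , 1≤i , i≤N , new)) _ _ = 1≤i , i≤N , new , here refl
    found (inj₂ _) 1≤N bad≡0 = ⊥-elim (n≮0 (subst (1 ≤_) bad≡0 (⊓-glb 1≤N ≤-refl)))

  module _ {m n : ℕ} {C : ℕ → ℕ → A} (rf : RainbowFree m n C) (m≤n : m ≤ n) where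

    -- The second color enters at s + 1 and the latest at u; each of the e colors after the second
    -- at least doubles the position.
    MainDiagonal : ℕ → List A → Set
    MainDiagonal X seen = (length seen ≤ X × length seen ≤ 1) ⊎
      ∃ λ s → ∃ λ e → ∃ λ u → 1 ≤ s × C s s ≢ C (suc s) (suc s) × 1 ≤ u × u ≤ X ×
        (∀ {z} → 1 ≤ z → z < u → C z z ≢ C u u) × length seen ≤ suc (suc e) × 2 ^ e * suc s ≤ u

    mainDiagonal : ∀ X → X ≤ m → ∃ λ seen →
      (∀ {z} → 1 ≤ z → z ≤ X → C z z ∈ seen) × MainDiagonal X seen
    mainDiagonal zero _ = [] , (λ 1≤z z≤0 → ⊥-elim (n≮0 (≤-trans 1≤z z≤0))) , inj₁ (z≤n , z≤n)
    mainDiagonal (suc X) X<m with mainDiagonal X (<⇒≤ X<m)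
    ... | seen , cover , shape with C (suc X) (suc X) ∈? seen
    ...   | yes old = seen
            , (λ 1≤z z≤X → [ (λ z<X → cover 1≤z (≤-pred z<X)) , (λ { refl → old }) ] (m≤n⇒m<n∨m≡n z≤X))
            , [ (λ (p , q) → inj₁ (m≤n⇒m≤1+n p , q)) , (λ (s , e , u , 1≤s , jump , 1≤u , u≤X , rest) →
                  inj₂ (s , e , u , 1≤s , jump , 1≤u , m≤n⇒m≤1+n u≤X , rest)) ] shape
    ...   | no new = C (suc X) (suc X) ∷ seen
            , (λ 1≤z z≤X → [ (λ z<X → there (cover 1≤z (≤-pred z<X)))
                           , (λ { refl → here refl }) ] (m≤n⇒m<n∨m≡n z≤X))
            , extend X X<m cover new shape
      where
      differs : ∀ {z X seen} → (∀ {z} → 1 ≤ z → z ≤ X → C z z ∈ seen) → C (suc X) (suc X) ∉ seen →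
        1 ≤ z → z ≤ X → C z z ≢ C (suc X) (suc X)
      differs {seen = seen} cover new 1≤z z≤X e = new (subst (_∈ seen) e (cover 1≤z z≤X))
      extend : ∀ X {seen} → X < m → (∀ {z} → 1 ≤ z → z ≤ X → C z z ∈ seen) →
        C (suc X) (suc X) ∉ seen →
        MainDiagonal X seen → MainDiagonal (suc X) (C (suc X) (suc X) ∷ seen)
      extend zero _ _ _ (inj₁ (p , _)) = inj₁ (s≤s p , s≤s p)
      extend X {seen} X<m cover new (inj₂ (s , e , u , 1≤s , jump , 1≤u , u≤X , first , len , pow))
        with o , refl ← m≤n⇒∃[o]m+o≡n u≤X =
        inj₂ (s , suc e , suc (u + o) , 1≤s , jump , s≤s z≤n , ≤-refl
             , (λ 1≤z z<u → differs cover new 1≤z (≤-pred z<u)) , s≤s len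
             , ≤-trans (≤-reflexive (*-assoc 2 (2 ^ e) (suc s))) (≤-trans (*-monoʳ-≤ 2 pow)
                 (≤-trans (+-monoʳ-≤ u (≤-trans (≤-reflexive (+-identityʳ u)) u≤o))
                          (≤-reflexive (+-suc u o)))))
        where
        -- The new color sits at u + (o + 1). For o + 1 < u the sum (o+1,o+1) + (u,u) would be
        -- rainbow, u being the first position of its color.
        u≤o : u ≤ suc o
        u≤o with ≤-<-connex u (suc o)
        ... | inj₁ h = h
        ... | inj₂ o<u with rf {suc o} {suc o} {u} {u} {suc (u + o)} {suc (u + o)} (s≤s z≤n) (s≤s z≤n)
                 1≤u 1≤u (cong suc (+-comm o u)) (cong suc (+-comm o u)) X<m (≤-trans X<m m≤n)
        ...   | inj₁ h = ⊥-elim (first (s≤s z≤n) o<u h)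
        ...   | inj₂ (inj₁ h) = ⊥-elim (differs cover new (s≤s z≤n) (≤-trans (<⇒≤ o<u) u≤X) h)
        ...   | inj₂ (inj₂ h) = ⊥-elim (differs cover new 1≤u u≤X h)
      extend (suc X) {seen} X<m cover new (inj₁ (_ , len)) =
        inj₂ (suc X , 0 , suc (suc X) , s≤s z≤n , differs cover new (s≤s z≤n) ≤-refl , s≤s z≤n , ≤-refl
             , (λ 1≤z z<u → differs cover new 1≤z (≤-pred z<u)) , s≤s len
             , ≤-reflexive (+-identityʳ (suc (suc X))))

    module Levels (seen₀ : List A) where

      upper lower : ℕ → ℕ → A
      upper k i = C i (k + i)
      lower k j = C (k + j) j

      sizeU sizeL : ℕ → ℕ
      sizeU k = m ⊓ (n ∸ k)
      sizeL k = n ⊓ (m ∸ k)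

      -- At each level the lower diagonal is tested against the list already extended by the upper
      -- one; hence their new colors differ.
      seen : ℕ → List A
      outU : ∀ k → Outcome (upper (suc k)) (sizeU (suc k)) (seen k)
      outL : ∀ k → Outcome (lower (suc k)) (sizeL (suc k)) (grow (outU k))
      seen zero = seen₀
      seen (suc k) = grow (outL k)
      outU k = outcome _ _ _
      outL k = outcome _ _ _

      badU badL rowU rowL : ℕ → ℕ
      badU zero = 0
      badU (suc k) = bad (outU k)
      badL zero = 0
      badL (suc k) = bad (outL k)
      rowU zero = 0
      rowU (suc k) = row (outU k)
      rowL zero = 0
      rowL (suc k) = row (outL k)

      sizeU-fits : ∀ {k i} → 1 ≤ i → i ≤ sizeU k → i ≤ m × k + i ≤ n
      sizeU-fits {k} 1≤i i≤ = m≤n⊓o⇒m≤n m (n ∸ k) i≤ , positive-∸ k 1≤i (m≤n⊓o⇒m≤o m (n ∸ k) i≤)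

      sizeL-fits : ∀ {k j} → 1 ≤ j → j ≤ sizeL k → j ≤ n × k + j ≤ m
      sizeL-fits {k} 1≤j j≤ = m≤n⊓o⇒m≤n n (m ∸ k) j≤ , positive-∸ k 1≤j (m≤n⊓o⇒m≤o n (m ∸ k) j≤)

      fits-sizeU : ∀ {k i} → i ≤ m → k + i ≤ n → i ≤ sizeU k
      fits-sizeU {k} i≤m ki≤n = ⊓-glb i≤m (m+n≤o⇒m≤o∸n _ (≤-trans (≤-reflexive (+-comm _ k)) ki≤n))

      fits-sizeL : ∀ {k j} → j ≤ n → k + j ≤ m → j ≤ sizeL k
      fits-sizeL {k} j≤n kj≤m = ⊓-glb j≤n (m+n≤o⇒m≤o∸n _ (≤-trans (≤-reflexive (+-comm _ k)) kj≤m))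

      seen-suc : ∀ k {p} → p ∈ seen k → p ∈ seen (suc k)
      seen-suc k = grow-⊇ (outL k) ∘ grow-⊇ (outU k)

      seen₀⊆ : ∀ k {p} → p ∈ seen₀ → p ∈ seen k
      seen₀⊆ zero p∈ = p∈
      seen₀⊆ (suc k) p∈ = seen-suc k (seen₀⊆ k p∈)

      -- Every nonempty diagonal contributes a new color or is bad.
      length-seen : ∀ k → length (seen k) + (total badU 1 k + total badL 1 k) ≤
        length seen₀ + (total (λ k → sizeU k ⊓ 1) 1 k + total (λ k → sizeL k ⊓ 1) 1 k)
      length-seen zero = ≤-refl
      length-seen (suc k)
        rewrite total-suc badU 1 k | total-suc badL 1 k
              | total-suc (λ k → sizeU k ⊓ 1) 1 k | total-suc (λ k → sizeL k ⊓ 1) 1 k =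
        combine (length seen₀) (total badU 1 k) (total badL 1 k)
                (total (λ k → sizeU k ⊓ 1) 1 k) (total (λ k → sizeL k ⊓ 1) 1 k)
                {length (seen k)} {length (grow (outU k))} {length (seen (suc k))}
                {bad (outU k)} {bad (outL k)} {sizeU (suc k) ⊓ 1} {sizeL (suc k) ⊓ 1}
                (length-seen k) (length-grow (outU k)) (length-grow (outL k))
        where
        combine : ∀ l₀ u v u′ v′ {l₁ l₂ l₃ x y x′ y′} → l₁ + (u + v) ≤ l₀ + (u′ + v′) →
          l₂ + x ≤ l₁ + x′ → l₃ + y ≤ l₂ + y′ →
          l₃ + ((u + x) + (v + y)) ≤ l₀ + ((u′ + x′) + (v′ + y′))
        combine l₀ u v u′ v′ {l₁} {l₂} {l₃} {x} {y} {x′} {y′} p q r =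
          linear 0 (+-mono-≤ p (+-mono-≤ q r))
            (solve (l₀ ∷ u ∷ v ∷ u′ ∷ v′ ∷ l₁ ∷ l₂ ∷ l₃ ∷ x ∷ y ∷ x′ ∷ y′ ∷ []))

      module _ (main : ∀ {z} → 1 ≤ z → z ≤ m → C z z ∈ seen₀) where

        Covered : ℕ → Set
        Covered k = ∀ {x y} → 1 ≤ x → x ≤ m → 1 ≤ y → y ≤ n → x ≤ k + y → y ≤ k + x → C x y ∈ seen k

        unseen-fresh : ∀ {k p} → Covered k → p ∉ seen k → Fresh m n C (suc k) p
        unseen-fresh {k} cover p∉ 1≤x x≤m 1≤y y≤n x< y< e =
          p∉ (subst (_∈ seen k) e (cover 1≤x x≤m 1≤y y≤n (≤-pred x<) (≤-pred y<)))

        -- Recording one new color suffices: the other points of the diagonal repeat it or a color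
        -- of D_0.
        upperCovered : ∀ k → Covered k → ∀ {x} → 1 ≤ x → x ≤ m → suc k + x ≤ n →
          C x (suc k + x) ∈ grow (outU k)
        upperCovered k cover {x} 1≤x x≤m kx≤n with outU k
        ... | inj₂ all = all 1≤x (fits-sizeU {suc k} x≤m kx≤n)
        ... | inj₁ (i , 1≤i , i≤ , new)
            with Diagonals.colorsOnDiagonal rf (s≤s z≤n)
                   (good 1≤i (proj₁ (sizeU-fits {suc k} 1≤i i≤)) (proj₂ (sizeU-fits {suc k} 1≤i i≤))
                     (unseen-fresh cover new)) 1≤x x≤m kx≤n
        ...   | inj₁ e = here e
        ...   | inj₂ (z , 1≤z , z≤m , _ , e , _) =
                there (subst (_∈ seen k) (sym e) (seen₀⊆ k (main 1≤z z≤m)))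

        lowerCovered : ∀ k → Covered k → ∀ {y} → 1 ≤ y → y ≤ n → suc k + y ≤ m →
          C (suc k + y) y ∈ grow (outL k)
        lowerCovered k cover {y} 1≤y y≤n ky≤m with outL k
        ... | inj₂ all = all 1≤y (fits-sizeL {suc k} y≤n ky≤m)
        ... | inj₁ (j , 1≤j , j≤ , new)
            with Diagonals.colorsOnDiagonal (flip-rainbowFree rf) (s≤s z≤n)
                   (good 1≤j (proj₁ (sizeL-fits {suc k} 1≤j j≤)) (proj₂ (sizeL-fits {suc k} 1≤j j≤))
                     (λ 1≤x x≤n 1≤y y≤m x< y< → unseen-fresh cover (new ∘ grow-⊇ (outU k))
                       1≤y y≤m 1≤x x≤n y< x<)) 1≤y y≤n ky≤m
        ...   | inj₁ e = here e
        ...   | inj₂ (z , 1≤z , _ , z≤m , e , _) =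
                there (grow-⊇ (outU k) (subst (_∈ seen k) (sym e) (seen₀⊆ k (main 1≤z z≤m))))

        covered : ∀ k → Covered k
        covered zero {x} 1≤x x≤m 1≤y y≤n x≤y y≤x with refl ← ≤-antisym x≤y y≤x = main 1≤x x≤m
        covered (suc k) {x} {y} 1≤x x≤m 1≤y y≤n x≤ y≤ with m≤n⇒m<n∨m≡n x≤ | m≤n⇒m<n∨m≡n y≤
        ... | inj₂ refl | _ = lowerCovered k (covered k) 1≤y y≤n x≤m
        ... | inj₁ _ | inj₂ refl = grow-⊇ (outL k) (upperCovered k (covered k) 1≤x x≤m y≤n)
        ... | inj₁ x< | inj₁ y< = seen-suc k (covered k 1≤x x≤m 1≤y y≤n (≤-pred x<) (≤-pred y<))

        foundU : ∀ k → suc k < n → 1 ≤ m → badU (suc k) ≡ 0 →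
          1 ≤ rowU (suc k) × rowU (suc k) ≤ sizeU (suc k) ×
          upper (suc k) (rowU (suc k)) ∉ seen k × upper (suc k) (rowU (suc k)) ∈ grow (outU k)
        foundU k k<n 1≤m = found (outU k) (⊓-glb 1≤m (m<n⇒0<n∸m k<n))

        foundL : ∀ k → suc k < m → 1 ≤ n → badL (suc k) ≡ 0 →
          1 ≤ rowL (suc k) × rowL (suc k) ≤ sizeL (suc k) ×
          lower (suc k) (rowL (suc k)) ∉ grow (outU k) × lower (suc k) (rowL (suc k)) ∈ grow (outL k)
        foundL k k<m 1≤n = found (outL k) (⊓-glb 1≤n (m<n⇒0<n∸m k<m))

    frame : 8 ≤ m → (∀ l → (∀ {x y} → 1 ≤ x → x ≤ m → 1 ≤ y → y ≤ n → C x y ∈ l) →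
      m + n + 1 ≤ length l) → Frame m n C
    frame 8≤m enough with mainDiagonal m ≤-refl
    ... | seen₀ , main , shape = build shape
      where
      open Levels seen₀
      8≤n = ≤-trans 8≤m m≤n
      1≤m : 1 ≤ m
      1≤m = ≤-trans (s≤s z≤n) 8≤m
      1≤n : 1 ≤ n
      1≤n = ≤-trans (s≤s z≤n) 8≤n
      b = total badU 0 (suc n) + total badL 0 (suc n)

      few : b + 3 ≤ length seen₀
      -- By level n ≥ m all diagonals are revealed; at most n - 1 above D_0 and m - 1 below it are
      -- nonempty.
      few = arithmetic (length (seen n)) (length seen₀) (total badU 1 n) (total badL 1 n)
        (enough (seen n) λ {x} {y} 1≤x x≤m 1≤y y≤n → covered main n 1≤x x≤m 1≤y y≤n
          (≤-trans x≤m (≤-trans m≤n (m≤m+n n y))) (≤-trans y≤n (m≤m+n n x)))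
        (length-seen n)
        (m≤o∸n⇒m+n≤o _ 1≤n (total-nonempty m n 1 n)) (m≤o∸n⇒m+n≤o _ 1≤m (total-nonempty n m 1 n))
        where
        arithmetic : ∀ l l₀ u v {u′ v′} → m + n + 1 ≤ l → l + (u + v) ≤ l₀ + (u′ + v′) →
          u′ + 1 ≤ n → v′ + 1 ≤ m → u + v + 3 ≤ l₀
        arithmetic l l₀ u v {u′} {v′} p q x y =
          linear 0 (+-mono-≤ p (+-mono-≤ q (+-mono-≤ x y)))
            (solve (l ∷ l₀ ∷ u ∷ v ∷ u′ ∷ v′ ∷ m ∷ n ∷ []))

      vanishU : ∀ k → suc n ≤ k → badU k ≡ 0
      vanishU (suc k) (s≤s n≤k) = n≤0⇒n≡0 (≤-trans (bad≤ (outU k))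
        (≤-trans (m⊓n≤m (sizeU (suc k)) 1) (≤-trans (m⊓n≤n m (n ∸ suc k))
          (≤-reflexive (m≤n⇒m∸n≡0 (m≤n⇒m≤1+n n≤k))))))

      vanishL : ∀ k → suc n ≤ k → badL k ≡ 0
      vanishL (suc k) (s≤s n≤k) = n≤0⇒n≡0 (≤-trans (bad≤ (outL k))
        (≤-trans (m⊓n≤m (sizeL (suc k)) 1) (≤-trans (m⊓n≤n n (m ∸ suc k))
          (≤-reflexive (m≤n⇒m∸n≡0 (m≤n⇒m≤1+n (≤-trans m≤n n≤k)))))))

      goodU′ : ∀ {k} → 1 ≤ k → k < n → badU k ≡ 0 → Good m n C k (rowU k)
      goodU′ {suc k} _ k<n p with foundU main k k<n 1≤m p
      ... | 1≤i , i≤ , new , _ = good 1≤i (proj₁ (sizeU-fits {suc k} 1≤i i≤))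
        (proj₂ (sizeU-fits {suc k} 1≤i i≤)) (unseen-fresh main (covered main k) new)

      goodL′ : ∀ {k} → 1 ≤ k → k < m → badL k ≡ 0 → Good n m (flip C) k (rowL k)
      goodL′ {suc k} _ k<m p with foundL main k k<m 1≤n p
      ... | 1≤j , j≤ , new , _ = good 1≤j (proj₁ (sizeL-fits {suc k} 1≤j j≤))
        (proj₂ (sizeL-fits {suc k} 1≤j j≤))
        (λ 1≤x x≤n 1≤y y≤m x< y< → unseen-fresh main (covered main k) (new ∘ grow-⊇ (outU k))
          1≤y y≤m 1≤x x≤n y< x<)

      apart′ : ∀ {k} → 1 ≤ k → k < n → k < m → badU k ≡ 0 → badL k ≡ 0 →
        C (rowU k) (k + rowU k) ≢ C (k + rowL k) (rowL k)
      apart′ {suc k} _ k<n k<m p q e with foundU main k k<n 1≤m p | foundL main k k<m 1≤n q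
      ... | _ , _ , _ , old | _ , _ , new , _ = new (subst (_∈ grow (outU k)) e old)

      build : MainDiagonal m seen₀ → Frame m n C
      build (inj₁ (_ , len)) = ⊥-elim (1+n≰n (≤-trans (s≤s (s≤s z≤n)) (≤-trans (m≤n+m 3 b) (≤-trans few len))))
      build (inj₂ (s , e , u , 1≤s , jump , _ , u≤m , first , len , pow)) = record
        { rainbowFree = rf ; 8≤m = 8≤m ; 8≤n = 8≤n
        ; badU = badU ; badL = badL ; rowU = rowU ; rowL = rowL
        ; boundU = total badU 0 (suc n) ; boundL = total badL 0 (suc n)
        ; totalU = total-bounded vanishU ; totalL = total-bounded vanishL
        ; goodU = goodU′ ; goodL = goodL′ ; apart = apart′
        ; s = s ; u = u ; 1≤s = 1≤s ; jump = jump ; u≤m = u≤m ; u≤n = ≤-trans u≤m m≤n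
        ; firstOccurrence = first
        -- From b + 3 ≤ σ ≤ e + 2 follows b + 1 ≤ e, and 2 e ≤ 2 ^ e makes the repeated doubling a
        -- linear bound.
        ; budget = ≤-trans (*-monoˡ-≤ (suc s) (≤-trans (*-monoʳ-≤ 2 b<e) (2*m≤2^m e))) pow
        }
        where
        b<e : suc b ≤ e
        b<e = ≤-pred (≤-pred (≤-trans (≤-reflexive (+-comm 3 b)) (≤-trans few len)))

-- From exact colorings of the grid to rainbow-free functions.

complete⇒≤length : ∀ {r} {l : List (Fin r)} → (∀ k → k ∈ l) → r ≤ length l
complete⇒≤length {l = l} complete = Fin.injective⇒≤ {f = index ∘ complete} λ {k} {k′} eq →
  trans (lookup-index (complete k)) (trans (cong (lookup l) eq) (sym (lookup-index (complete k′))))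

theorem5p4 : (m n : ℕ) → 8 ≤ m → m ≤ n →
    (c : Coloring m n (m + n + 1)) → Exact c → RainbowSolution c
theorem5p4 m n 8≤m m≤n c exact = decide rainbow?
  where
  inGrid? : ∀ p → Dec (InGrid m n p)
  inGrid? (i , j) = (1 ≤? i ×-dec i ≤? m) ×-dec (1 ≤? j ×-dec j ≤? n)

  -- A coloring takes membership proofs as input, so its value must be shown independent of them.
  inGrid-irrelevant : ∀ {p} (x y : InGrid m n p) → x ≡ y
  inGrid-irrelevant (( a , b) , (e , f)) ((a′ , b′) , (e′ , f′)) =
    cong₂ _,_ (cong₂ _,_ (≤-irrelevant a a′) (≤-irrelevant b b′))
              (cong₂ _,_ (≤-irrelevant e e′) (≤-irrelevant f f′))

  1≤m : 1 ≤ m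
  1≤m = ≤-trans (s≤s z≤n) 8≤m

  corner : Grid m n
  corner = (1 , 1) , (≤-refl , 1≤m) , (≤-refl , ≤-trans 1≤m m≤n)

  -- Outside the grid, C takes the junk value c (1 , 1).
  C : ℕ → ℕ → Fin (m + n + 1)
  C i j with inGrid? (i , j)
  ... | yes p = c ((i , j) , p)
  ... | no _ = c corner

  C-grid : ∀ {i j} (p : InGrid m n (i , j)) → C i j ≡ c ((i , j) , p)
  C-grid {i} {j} p with inGrid? (i , j)
  ... | yes q = cong (λ x → c ((i , j) , x)) (inGrid-irrelevant q p)
  ... | no ¬p = ⊥-elim (¬p p)

  Rainbow : ℕ → ℕ → ℕ → ℕ → Set
  Rainbow a b a′ b′ = (1 ≤ a × 1 ≤ b × 1 ≤ a′ × 1 ≤ b′ × a + a′ ≤ m × b + b′ ≤ n) ×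
    (C a b ≢ C a′ b′ × C a b ≢ C (a + a′) (b + b′) × C a′ b′ ≢ C (a + a′) (b + b′))

  -- The bounds make this decidable, so that refuting its negation yields an actual solution.
  Rainbows : Set
  Rainbows = ∃ λ a → a < suc m × ∃ λ b → b < suc n × ∃ λ a′ → a′ < suc m × ∃ λ b′ → b′ < suc n ×
    Rainbow a b a′ b′

  rainbow? : Dec Rainbows
  rainbow? = anyUpTo? (λ a → anyUpTo? (λ b → anyUpTo? (λ a′ → anyUpTo? (λ b′ →
    (1 ≤? a ×-dec 1 ≤? b ×-dec 1 ≤? a′ ×-dec 1 ≤? b′ ×-dec a + a′ ≤? m ×-dec b + b′ ≤? n) ×-dec
    (¬? (C a b Fin.≟ C a′ b′) ×-dec ¬? (C a b Fin.≟ C (a + a′) (b + b′)) ×-dec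
      ¬? (C a′ b′ Fin.≟ C (a + a′) (b + b′))))
    (suc n)) (suc m)) (suc n)) (suc m)

  rainbowFree : ¬ Rainbows → RainbowFree m n C
  rainbowFree none {a} {b} {a′} {b′} 1≤a 1≤b 1≤a′ 1≤b′ refl refl e≤m f≤n
    with C a b Fin.≟ C a′ b′ | C a b Fin.≟ C (a + a′) (b + b′) | C a′ b′ Fin.≟ C (a + a′) (b + b′)
  ... | yes e | _ | _ = inj₁ e
  ... | no _ | yes e | _ = inj₂ (inj₁ e)
  ... | no _ | no _ | yes e = inj₂ (inj₂ e)
  ... | no x | no y | no z = ⊥-elim (none
    (a , s≤s (m+n≤o⇒m≤o a e≤m) , b , s≤s (m+n≤o⇒m≤o b f≤n) ,
     a′ , s≤s (m+n≤o⇒n≤o a e≤m) , b′ , s≤s (m+n≤o⇒n≤o b f≤n) ,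
     (1≤a , 1≤b , 1≤a′ , 1≤b′ , e≤m , f≤n) , x , y , z))

  decide : Dec Rainbows → RainbowSolution c
  decide (no none) = ⊥-elim (noFrame (Greedy.frame Fin._≟_ (rainbowFree none) m≤n 8≤m enough))
    where
    enough : ∀ l → _ → m + n + 1 ≤ length l
    enough l cover = complete⇒≤length λ k → member k (exact k)
      where
      member : ∀ k → (∃ λ p → c p ≡ k) → _
      member k (((x , y) , p@((1≤x , x≤m) , (1≤y , y≤n))) , e) =
        subst (_∈ l) (trans (C-grid p) e) (cover 1≤x x≤m 1≤y y≤n)
  decide (yes (a , _ , b , _ , a′ , _ , b′ , _ , (1≤a , 1≤b , 1≤a′ , 1≤b′ , e≤m , f≤n) , x , y , z)) =
    α , β , γ , refl , differ x , differ y , differ z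
    where
    α β γ : Grid m n
    α = (a , b) , (1≤a , m+n≤o⇒m≤o a e≤m) , (1≤b , m+n≤o⇒m≤o b f≤n)
    β = (a′ , b′) , (1≤a′ , m+n≤o⇒n≤o a e≤m) , (1≤b′ , m+n≤o⇒n≤o b f≤n)
    γ = (a + a′ , b + b′) , (≤-trans 1≤a (m≤m+n a a′) , e≤m) , (≤-trans 1≤b (m≤m+n b b′) , f≤n)
    differ : ∀ {i j i′ j′} {p : InGrid m n (i , j)} {q : InGrid m n (i′ , j′)} →
      C i j ≢ C i′ j′ → c ((i , j) , p) ≢ c ((i′ , j′) , q)
    differ {p = p} {q} ne e = ne (trans (C-grid p) (trans e (sym (C-grid q))))
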